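{- Let $\mathcal C$ be a cartesian $R$-differential category, where $R$ has multiplicative inverses for integers. For every $n\in\mathbb N$, the operators $T_n$ and $\tilde T_n$ are functors $\mathcal C\to\mathcal C$, with action on objects $T_nX=\tilde T_nX=S_nX$; that is, $T_n(\mathrm{id})=\mathrm{id}$, $T_n(g\circ f)=T_ng\circ T_nf$, and likewise for $\tilde T_n$.
   Context: $R$ is a commutative semiring with multiplicative inverses for integers: for each integer $n\ge1$ there is $\frac1n\in R$ with $\frac1n\cdot(1_R+\cdots+1_R)=1_R$ ($n$ summands). A map between $R$-semimodules is $R$-additive if it preserves sums, $0$ and the action of $R$. A left $R$-additive category is a category $\mathcal C$ whose hom-sets are $R$-semimodules and such that every precomposition map $\_\circ f$ is $R$-additive; a morphism $h:Y\to Z$ is $R$-additive if every postcomposition map $h\circ\_:\mathcal C(X,Y)\to\mathcal C(X,Z)$ is $R$-additive. A cartesian left $R$-additive category is one with finite products whose projections are $R$-additive. $\langle\cdots\rangle$ denotes tupling. Put $SX=X\times X$ with projections $\pi_0,\pi_1:SX\to X$. A derivative is a family of operators $D:\mathcal C(X,Y)\to\mathcal C(SX,Y)$ such that: (i) $Dp=p\circ\pi_1$ for every product projection $p:X_0\times\cdots\times X_n\to X_i$; (ii) $D$ is $R$-additive; (iii) $D\,\mathrm{id}=\pi_1$ and $D(g\circ f)=Dg\circ\langle f\circ\pi_0,Df\rangle$; (iv) $Df$ is $R$-additive in its second argument, i.e. $u\mapsto Df\circ\langle x,u\rangle$ is $R$-additive; (v) $DDf\circ\langle\langle x,0\rangle,\langle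 0,u\rangle\rangle=Df\circ\langle x,u\rangle$; (vi) $DDf\circ\langle\langle x,u\rangle,\langle v,w\rangle\rangle=DDf\circ\langle\langle x,v\rangle,\langle u,w\rangle\rangle$. A cartesian $R$-differential category is a cartesian left $R$-additive category with a derivative. $S_nX=X^{n+1}$ with projections $\pi_0,\dots,\pi_n:S_nX\to X$; for $m\le n$, $s_{n\to m}=\langle\pi_0,\dots,\pi_m\rangle:S_nX\to S_mX$. For $n\ge1$ define $\nu_n,\tilde\nu_n:S_nX\to SS_{n-1}X$ by $\nu_n=\langle\langle\pi_0,\dots,\pi_{n-1}\rangle,\langle\tfrac1n\pi_1,\tfrac2n\pi_2,\dots,\tfrac nn\pi_n\rangle\rangle$ and $\tilde\nu_n=\langle\langle\pi_0,\dots,\pi_{n-1}\rangle,\langle\pi_1,\dots,\pi_n\rangle\rangle$. For $f\in\mathcal C(X,Y)$ define $t_nf,\tilde t_nf:S_nX\to Y$ by $t_0f=\tilde t_0f=f$, $t_{n+1}f=D(t_nf)\circ\nu_{n+1}$, $\tilde t_{n+1}f=D(\tilde t_nf)\circ\tilde\nu_{n+1}$. Define $T_nf,\tilde T_nf:S_nX\to S_nY$ by $\pi_i\circ T_nf=t_if\circ s_{n\to i}$ and $\pi_i\circ\tilde T_nf=\tilde t_if\circ s_{n\to i}$ for $0\le i\le n$. -}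

module Defs where

open import Algebra.Bundles using (CommutativeSemiring)
open import Algebra.Core using (Op₂)
open import Algebra.Module.Bundles using (Semimodule)
open import Algebra.Module.Core using (Opₗ; Opᵣ)
open import Algebra.Module.Structures using (IsSemimodule)
import Algebra.Module.Morphism.Structures as ModuleMorphisms
import Algebra.Definitions.RawSemiring as RawSemiringDefinitions
open import Data.Fin.Base using (Fin; zero; suc; toℕ; inject≤)
open import Data.Fin.Properties using (toℕ≤pred[n])
open import Data.Nat.Base using (ℕ; zero; suc; _≤_; s≤s; NonZero)
open import Data.Nat.Properties using (n≤1+n)
open import Data.Vec.Functional using (Vector; head; tail; replicate)
open import Level using (Level; _⊔_) renaming (suc to lsuc)
open import Relation.Binary.Core using (Rel)
open import Relation.Binary.Structures using (IsEquivalence)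

record HasReciprocals {r ℓr} (R : CommutativeSemiring r ℓr) : Set (r ⊔ ℓr) where
  open CommutativeSemiring R using (Carrier; _≈_; _*_; 1#; rawSemiring)
  open RawSemiringDefinitions rawSemiring using (_×_)
  infix 8 1/_
  infix 7 _/_
  field
    1/_         : (n : ℕ) .{{_ : NonZero n}} → Carrier
    1/-inverse  : (n : ℕ) .{{_ : NonZero n}} → 1/ n * (n × 1#) ≈ 1#

  _/_ : ℕ → (n : ℕ) .{{_ : NonZero n}} → Carrier
  k / n = (k × 1#) * 1/ n

-- Equality of morphisms is an equivalence relation _≈_ on each hom-set.
record Category (o ℓ e : Level) : Set (lsuc (o ⊔ ℓ ⊔ e)) where
  infix  4 _≈_ _⇒_
  infixr 9 _∘_
  field
    Obj           : Set o
    _⇒_           : Obj → Obj → Set ℓ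
    _≈_           : ∀ {X Y} → Rel (X ⇒ Y) e
    id            : ∀ {X} → X ⇒ X
    _∘_           : ∀ {X Y Z} → Y ⇒ Z → X ⇒ Y → X ⇒ Z
    isEquivalence : ∀ {X Y} → IsEquivalence (_≈_ {X} {Y})
    ∘-cong        : ∀ {X Y Z} {g g′ : Y ⇒ Z} {f f′ : X ⇒ Y} →
                    g ≈ g′ → f ≈ f′ → g ∘ f ≈ g′ ∘ f′
    identityˡ     : ∀ {X Y} {f : X ⇒ Y} → id ∘ f ≈ f
    identityʳ     : ∀ {X Y} {f : X ⇒ Y} → f ∘ id ≈ f
    assoc         : ∀ {W X Y Z} {f : W ⇒ X} {g : X ⇒ Y} {h : Y ⇒ Z} →
                    (h ∘ g) ∘ f ≈ h ∘ (g ∘ f)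

record IsFunctor {o ℓ e o′ ℓ′ e′} (C : Category o ℓ e) (C′ : Category o′ ℓ′ e′)
                 (F₀ : Category.Obj C → Category.Obj C′)
                 (F₁ : ∀ {X Y} → Category._⇒_ C X Y → Category._⇒_ C′ (F₀ X) (F₀ Y))
                 : Set (o ⊔ ℓ ⊔ e ⊔ e′) where
  private
    module C  = Category C
    module C′ = Category C′
  field
    F-cong     : ∀ {X Y} {f g : X C.⇒ Y} → f C.≈ g → F₁ f C′.≈ F₁ g
    F-identity : ∀ {X} → F₁ (C.id {X}) C′.≈ C′.id
    F-∘        : ∀ {X Y Z} {f : X C.⇒ Y} {g : Y C.⇒ Z} →
                 F₁ (g C.∘ f) C′.≈ F₁ g C′.∘ F₁ f

record FiniteProducts {o ℓ e} (C : Category o ℓ e) : Set (o ⊔ ℓ ⊔ e) where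
  open Category C
  infixr 7 _×_
  field
    ⊤        : Obj
    !        : ∀ {A} → A ⇒ ⊤
    !-unique : ∀ {A} (f : A ⇒ ⊤) → f ≈ !

    _×_      : Obj → Obj → Obj
    π₀       : ∀ {X Y} → X × Y ⇒ X
    π₁       : ∀ {X Y} → X × Y ⇒ Y
    ⟨_,_⟩    : ∀ {A X Y} → A ⇒ X → A ⇒ Y → A ⇒ X × Y
    π₀-⟨⟩    : ∀ {A X Y} {f : A ⇒ X} {g : A ⇒ Y} → π₀ ∘ ⟨ f , g ⟩ ≈ f
    π₁-⟨⟩    : ∀ {A X Y} {f : A ⇒ X} {g : A ⇒ Y} → π₁ ∘ ⟨ f , g ⟩ ≈ g
    ⟨⟩-unique : ∀ {A X Y} {f : A ⇒ X} {g : A ⇒ Y} {h : A ⇒ X × Y} →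
                π₀ ∘ h ≈ f → π₁ ∘ h ≈ g → h ≈ ⟨ f , g ⟩

  -- X₀ × (X₁ × (⋯ × Xₙ)); a one-fold product is the object itself, and a
  -- two-fold product is definitionally X₀ × X₁.
  ∏ : ∀ {n} → Vector Obj (suc n) → Obj
  ∏ {zero}  X = head X
  ∏ {suc n} X = head X × ∏ (tail X)

  proj : ∀ {n} (X : Vector Obj (suc n)) (i : Fin (suc n)) → ∏ X ⇒ X i
  proj {zero}  X zero    = id
  proj {suc n} X zero    = π₀
  proj {suc n} X (suc i) = proj (tail X) i ∘ π₁

  tuple : ∀ {n A} (X : Vector Obj (suc n)) → ((i : Fin (suc n)) → A ⇒ X i) → A ⇒ ∏ X
  tuple {zero}  X f = f zero
  tuple {suc n} X f = ⟨ f zero , tuple (tail X) (λ i → f (suc i)) ⟩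

IsSemimoduleHom : ∀ {r ℓr m ℓm m′ ℓm′} {R : CommutativeSemiring r ℓr}
                  (M : Semimodule R m ℓm) (N : Semimodule R m′ ℓm′) →
                  (Semimodule.Carrierᴹ M → Semimodule.Carrierᴹ N) → Set (r ⊔ m ⊔ ℓm ⊔ ℓm′)
IsSemimoduleHom M N = IsSemimoduleHomomorphism
  where
  open ModuleMorphisms.SemimoduleMorphisms
    (Semimodule.rawSemimodule M) (Semimodule.rawSemimodule N)

record LeftAdditiveCategory {r ℓr} (R : CommutativeSemiring r ℓr) (o ℓ e : Level)
                            : Set (r ⊔ ℓr ⊔ lsuc (o ⊔ ℓ ⊔ e)) where
  field
    category : Category o ℓ e
  open Category category public
  open CommutativeSemiring R using () renaming (Carrier to Scalar)
  infixl 6 _+_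
  infixr 7 _*ₗ_
  infixl 7 _*ᵣ_
  field
    _+_          : ∀ {X Y} → Op₂ (X ⇒ Y)
    0ₘ           : ∀ {X Y} → X ⇒ Y
    _*ₗ_         : ∀ {X Y} → Opₗ Scalar (X ⇒ Y)
    _*ᵣ_         : ∀ {X Y} → Opᵣ Scalar (X ⇒ Y)
    isSemimodule : ∀ {X Y} → IsSemimodule R (_≈_ {X} {Y}) _+_ 0ₘ _*ₗ_ _*ᵣ_

  hom : Obj → Obj → Semimodule R ℓ e
  hom X Y = record { isSemimodule = isSemimodule {X} {Y} }

  IsAdditiveMap : ∀ {W X Y Z} → (W ⇒ X → Y ⇒ Z) → Set (r ⊔ ℓ ⊔ e)
  IsAdditiveMap {W} {X} {Y} {Z} = IsSemimoduleHom (hom W X) (hom Y Z)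

  IsAdditive : ∀ {Y Z} → Y ⇒ Z → Set (r ⊔ o ⊔ ℓ ⊔ e)
  IsAdditive {Y} h = ∀ {X} → IsAdditiveMap {X} {Y} (λ f → h ∘ f)

  field
    precomposition-additive : ∀ {X Y Z} (f : X ⇒ Y) → IsAdditiveMap {Y} {Z} (λ g → g ∘ f)

record CartesianLeftAdditiveCategory {r ℓr} (R : CommutativeSemiring r ℓr) (o ℓ e : Level)
                                     : Set (r ⊔ ℓr ⊔ lsuc (o ⊔ ℓ ⊔ e)) where
  field
    leftAdditiveCategory : LeftAdditiveCategory R o ℓ e
  open LeftAdditiveCategory leftAdditiveCategory public
  field
    finiteProducts : FiniteProducts category
  open FiniteProducts finiteProducts public
  field
    π₀-additive : ∀ {X Y} → IsAdditive (π₀ {X} {Y})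
    π₁-additive : ∀ {X Y} → IsAdditive (π₁ {X} {Y})

record CartesianDifferentialCategory {r ℓr} (R : CommutativeSemiring r ℓr) (o ℓ e : Level)
                                     : Set (r ⊔ ℓr ⊔ lsuc (o ⊔ ℓ ⊔ e)) where
  field
    cartesianLeftAdditiveCategory : CartesianLeftAdditiveCategory R o ℓ e
  open CartesianLeftAdditiveCategory cartesianLeftAdditiveCategory public
  field
    D : ∀ {X Y} → X ⇒ Y → X × X ⇒ Y

    D-proj     : ∀ {n} (X : Vector Obj (suc n)) (i : Fin (suc n)) →
                 D (proj X i) ≈ proj X i ∘ π₁
    D-additive : ∀ {X Y} → IsAdditiveMap (D {X} {Y})
    D-id       : ∀ {X} → D (id {X}) ≈ π₁
    D-∘        : ∀ {X Y Z} {f : X ⇒ Y} {g : Y ⇒ Z} →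
                 D (g ∘ f) ≈ D g ∘ ⟨ f ∘ π₀ , D f ⟩
    D-additive₂ : ∀ {A X Y} (f : X ⇒ Y) (x : A ⇒ X) →
                  IsAdditiveMap (λ u → D f ∘ ⟨ x , u ⟩)
    DD-linear  : ∀ {A X Y} {f : X ⇒ Y} {x u : A ⇒ X} →
                 D (D f) ∘ ⟨ ⟨ x , 0ₘ ⟩ , ⟨ 0ₘ , u ⟩ ⟩ ≈ D f ∘ ⟨ x , u ⟩
    DD-symmetric : ∀ {A X Y} {f : X ⇒ Y} {x u v w : A ⇒ X} →
                   D (D f) ∘ ⟨ ⟨ x , u ⟩ , ⟨ v , w ⟩ ⟩ ≈ D (D f) ∘ ⟨ ⟨ x , v ⟩ , ⟨ u , w ⟩ ⟩

module Taylor {r ℓr o ℓ e} {R : CommutativeSemiring r ℓr} (reciprocals : HasReciprocals R)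
              (C : CartesianDifferentialCategory R o ℓ e) where
  open HasReciprocals reciprocals
  open CartesianDifferentialCategory C

  S : ℕ → Obj → Obj
  S n X = ∏ (replicate (suc n) X)

  π : ∀ {n X} → Fin (suc n) → S n X ⇒ X
  π {n} {X} = proj (replicate (suc n) X)

  tupleS : ∀ n {A X} → (Fin (suc n) → A ⇒ X) → A ⇒ S n X
  tupleS n {X = X} = tuple (replicate (suc n) X)

  s : ∀ {n m X} → m ≤ n → S n X ⇒ S m X
  s {m = m} m≤n = tupleS m (λ i → π (inject≤ i (s≤s m≤n)))

  -- ν and ν̃ are indexed by the predecessor: ν n and ν̃ n are νₙ₊₁ and ν̃ₙ₊₁.
  ν : ∀ n {X} → S (suc n) X ⇒ S n X × S n X
  ν n = ⟨ s (n≤1+n n) , tupleS n (λ i → (suc (toℕ i) / suc n) *ₗ π (suc i)) ⟩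

  ν̃ : ∀ n {X} → S (suc n) X ⇒ S n X × S n X
  ν̃ n = ⟨ s (n≤1+n n) , tupleS n (λ i → π (suc i)) ⟩

  t : ∀ n {X Y} → X ⇒ Y → S n X ⇒ Y
  t zero    f = f
  t (suc n) f = D (t n f) ∘ ν n

  t̃ : ∀ n {X Y} → X ⇒ Y → S n X ⇒ Y
  t̃ zero    f = f
  t̃ (suc n) f = D (t̃ n f) ∘ ν̃ n

  T : ∀ n {X Y} → X ⇒ Y → S n X ⇒ S n Y
  T n f = tupleS n (λ i → t (toℕ i) f ∘ s (toℕ≤pred[n] i))

  T̃ : ∀ n {X Y} → X ⇒ Y → S n X ⇒ S n Y
  T̃ n f = tupleS n (λ i → t̃ (toℕ i) f ∘ s (toℕ≤pred[n] i))

{-# OPTIONS --safe #-}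

-- By the chain rule and linearity of D in its second argument,
--   D (tₘ f ∘ s) ∘ νₙ₊₁ ≈ (m+1)/(n+1) · (tₘ₊₁ f ∘ s)   for m ≤ n:
-- the weights of νₙ₊₁ and νₘ₊₁ differ by the constant factor (m+1)/(n+1). Hence
-- ⟨ Tₙ f ∘ π₀ , D (Tₙ f) ⟩ ∘ νₙ₊₁ ≈ νₙ₊₁ ∘ Tₙ₊₁ f, and tₙ (g ∘ f) ≈ tₙ g ∘ Tₙ f follows
-- by induction on n. Only the multiplicativity of the weights matters, so the
-- argument covers T̃, whose weights are all 1, as well.

module Submission where

open import Defs
open import Algebra.Bundles using (CommutativeSemiring)
import Algebra.Definitions.RawSemiring as RawSemiringDefinitions
open import Algebra.Module.Bundles using (Semimodule)
open import Algebra.Module.Structures using (IsSemimodule)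
import Algebra.Module.Morphism.Structures as ModuleMorphisms
open import Data.Fin.Base using (Fin; zero; suc; toℕ; fromℕ; inject≤)
open import Data.Fin.Properties
  using (toℕ≤pred[n]; toℕ-inject≤; toℕ-fromℕ; inject≤-trans; toℕ-injective)
open import Data.Nat.Base using (ℕ; zero; suc; _≤_; s≤s)
open import Data.Nat.Properties using (≤-trans; n≤1+n)
open import Data.Vec.Functional using (Vector; tail; replicate)
open import Level using (Level)
open import Relation.Binary.Bundles using (Setoid)
open import Relation.Binary.PropositionalEquality as ≡ using (_≡_)
import Relation.Binary.Reasoning.Setoid as SetoidReasoning
open import Relation.Binary.Structures using (IsEquivalence)

-- Tuples, scalars and the chain rule.

module DifferentialLemmas {r ℓr o ℓ e} {R : CommutativeSemiring r ℓr}
  (C : CartesianDifferentialCategory R o ℓ e) where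
  open CartesianDifferentialCategory C

  homSetoid : Obj → Obj → Setoid ℓ e
  homSetoid X Y = record { isEquivalence = isEquivalence {X} {Y} }

  module _ {X Y : Obj} where
    open IsEquivalence (isEquivalence {X} {Y}) public using (refl; sym; trans)
    open IsSemimodule (isSemimodule {X} {Y}) public
      using (*ₗ-cong; *ₗ-assoc; *ₗ-identityˡ)
    open SetoidReasoning (homSetoid X Y) public

  ∘-congˡ : ∀ {X Y Z} {g : Y ⇒ Z} {f f′ : X ⇒ Y} → f ≈ f′ → g ∘ f ≈ g ∘ f′
  ∘-congˡ = ∘-cong refl

  ∘-congʳ : ∀ {X Y Z} {g g′ : Y ⇒ Z} {f : X ⇒ Y} → g ≈ g′ → g ∘ f ≈ g′ ∘ f
  ∘-congʳ p = ∘-cong p refl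

  pullˡ : ∀ {W X Y Z} {f : W ⇒ X} {g : X ⇒ Y} {h : Y ⇒ Z} {k : X ⇒ Z} →
          h ∘ g ≈ k → h ∘ (g ∘ f) ≈ k ∘ f
  pullˡ p = trans (sym assoc) (∘-congʳ p)

  pullʳ : ∀ {W X Y Z} {f : W ⇒ X} {g : X ⇒ Y} {h : Y ⇒ Z} {k : W ⇒ Y} →
          g ∘ f ≈ k → (h ∘ g) ∘ f ≈ h ∘ k
  pullʳ p = trans assoc (∘-congˡ p)

  ×-ext : ∀ {A X Y} {f g : A ⇒ X × Y} → π₀ ∘ f ≈ π₀ ∘ g → π₁ ∘ f ≈ π₁ ∘ g → f ≈ g
  ×-ext p q = trans (⟨⟩-unique p q) (sym (⟨⟩-unique refl refl))

  ⟨⟩-cong : ∀ {A X Y} {f f′ : A ⇒ X} {g g′ : A ⇒ Y} →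
            f ≈ f′ → g ≈ g′ → ⟨ f , g ⟩ ≈ ⟨ f′ , g′ ⟩
  ⟨⟩-cong p q = ⟨⟩-unique (trans π₀-⟨⟩ p) (trans π₁-⟨⟩ q)

  ⟨⟩-∘ : ∀ {A B X Y} {f : B ⇒ X} {g : B ⇒ Y} {h : A ⇒ B} →
         ⟨ f , g ⟩ ∘ h ≈ ⟨ f ∘ h , g ∘ h ⟩
  ⟨⟩-∘ = ⟨⟩-unique (pullˡ π₀-⟨⟩) (pullˡ π₁-⟨⟩)

  proj-ext : ∀ {n A} (X : Vector Obj (suc n)) {f g : A ⇒ ∏ X} →
             (∀ i → proj X i ∘ f ≈ proj X i ∘ g) → f ≈ g
  proj-ext {zero}  X p = trans (sym identityˡ) (trans (p zero) identityˡ)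
  proj-ext {suc n} X p =
    ×-ext (p zero) (proj-ext (tail X) λ i → trans (sym assoc) (trans (p (suc i)) assoc))

  proj-tuple : ∀ {n A} (X : Vector Obj (suc n)) (f : ∀ i → A ⇒ X i) i →
               proj X i ∘ tuple X f ≈ f i
  proj-tuple {zero}  X f zero    = identityˡ
  proj-tuple {suc n} X f zero    = π₀-⟨⟩
  proj-tuple {suc n} X f (suc i) =
    trans (pullʳ π₁-⟨⟩) (proj-tuple (tail X) (λ j → f (suc j)) i)

  module _ {W X Y Z} {F : W ⇒ X → Y ⇒ Z} (F-additive : IsAdditiveMap F) where
    open ModuleMorphisms.SemimoduleMorphisms
      (Semimodule.rawSemimodule (hom W X)) (Semimodule.rawSemimodule (hom Y Z))
    open IsSemimoduleHomomorphism F-additive public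
      using () renaming (⟦⟧-cong to additive-cong; *ₗ-homo to additive-*ₗ)

  *ₗ-∘ : ∀ {X Y Z} c (g : Y ⇒ Z) (f : X ⇒ Y) → (c *ₗ g) ∘ f ≈ c *ₗ (g ∘ f)
  *ₗ-∘ c g f = additive-*ₗ (precomposition-additive f) c g

  -- Homogeneity is assumed for the binary projections; an iterated projection is a composite of
  -- these, so it inherits it by recursion.
  proj-*ₗ : ∀ {n A} (X : Vector Obj (suc n)) i c (f : A ⇒ ∏ X) →
            proj X i ∘ (c *ₗ f) ≈ c *ₗ (proj X i ∘ f)
  proj-*ₗ {zero}  X zero    c f =
    trans identityˡ (*ₗ-cong (CommutativeSemiring.refl R) (sym identityˡ))
  proj-*ₗ {suc n} X zero    c f = additive-*ₗ π₀-additive c f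
  proj-*ₗ {suc n} X (suc i) c f = begin
    (proj (tail X) i ∘ π₁) ∘ (c *ₗ f)   ≈⟨ pullʳ (additive-*ₗ π₁-additive c f) ⟩
    proj (tail X) i ∘ (c *ₗ (π₁ ∘ f))   ≈⟨ proj-*ₗ (tail X) i c (π₁ ∘ f) ⟩
    c *ₗ (proj (tail X) i ∘ (π₁ ∘ f))   ≈⟨ *ₗ-cong (CommutativeSemiring.refl R) assoc ⟨
    c *ₗ ((proj (tail X) i ∘ π₁) ∘ f)   ∎

  D-cong : ∀ {X Y} {f g : X ⇒ Y} → f ≈ g → D f ≈ D g
  D-cong = additive-cong D-additive

  -- Keeps the argument `h` whole, so that the chain rule applies at `h = ν n` without splitting
  -- `ν n` into a pair.
  D-∘₂ : ∀ {A X Y Z} (g : Y ⇒ Z) (f : X ⇒ Y) (h : A ⇒ X × X) →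
         D (g ∘ f) ∘ h ≈ D g ∘ ⟨ f ∘ (π₀ ∘ h) , D f ∘ h ⟩
  D-∘₂ g f h = trans (∘-congʳ D-∘) (pullʳ (trans ⟨⟩-∘ (⟨⟩-cong assoc refl)))

  -- By `D-proj` the derivative of a projection ignores the base point, so only the `D f` component
  -- of the chain rule survives. This lets `D` be computed coordinatewise.
  proj-D : ∀ {n A} (X : Vector Obj (suc n)) i (f : A ⇒ ∏ X) →
           proj X i ∘ D f ≈ D (proj X i ∘ f)
  proj-D X i f = begin
    proj X i ∘ D f                              ≈⟨ pullʳ π₁-⟨⟩ ⟨
    (proj X i ∘ π₁) ∘ ⟨ f ∘ π₀ , D f ⟩          ≈⟨ ∘-congʳ (D-proj X i) ⟨
    D (proj X i) ∘ ⟨ f ∘ π₀ , D f ⟩             ≈⟨ D-∘ ⟨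
    D (proj X i ∘ f)                            ∎

-- ν and t are kept abstract, subject to their defining equations, because the ν̃ of Defs
-- carries no scalars and so satisfies the weighted form of these equations only up to ≈.
module WeightedTaylor {r ℓr o ℓ e} {R : CommutativeSemiring r ℓr}
  (reciprocals : HasReciprocals R) (C : CartesianDifferentialCategory R o ℓ e) where
  open CartesianDifferentialCategory C
  open Taylor reciprocals C using (S; π; tupleS; s)
  open DifferentialLemmas C
  private
    module R = CommutativeSemiring R

  -- Coordinates, truncations and weights.

  π-ext : ∀ n {A X} {f g : A ⇒ S n X} → (∀ i → π {n} i ∘ f ≈ π {n} i ∘ g) → f ≈ g
  π-ext n = proj-ext (replicate (suc n) _)

  π-tuple : ∀ n {A X} (f : Fin (suc n) → A ⇒ X) i → π {n} i ∘ tupleS n f ≈ f i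
  π-tuple n = proj-tuple (replicate (suc n) _)

  π-s : ∀ {m n X} (m≤n : m ≤ n) i →
        π {m} {X} i ∘ s m≤n ≈ π {n} (inject≤ i (s≤s m≤n))
  π-s {m} {n} m≤n = π-tuple m (λ i → π {n} (inject≤ i (s≤s m≤n)))

  -- `l≤n` is a free argument: `inject≤` is irrelevant in its inequality, so all proofs of it yield
  -- the same truncation.
  s-∘ : ∀ {l m n X} (l≤m : l ≤ m) (m≤n : m ≤ n) (l≤n : l ≤ n) →
        s {X = X} l≤m ∘ s m≤n ≈ s l≤n
  s-∘ {l} {m} {n} l≤m m≤n l≤n = π-ext l λ i → begin
    π i ∘ (s l≤m ∘ s m≤n)                               ≈⟨ pullˡ (π-s l≤m i) ⟩
    π {m} (inject≤ i (s≤s l≤m)) ∘ s m≤n                 ≈⟨ π-s m≤n _ ⟩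
    π {n} (inject≤ (inject≤ i (s≤s l≤m)) (s≤s m≤n))
      ≡⟨ ≡.cong (π {n}) (inject≤-trans i _ _) ⟩
    π {n} (inject≤ i (s≤s l≤n))                         ≈⟨ π-s l≤n i ⟨
    π i ∘ s l≤n                                         ∎

  -- `w k n` is the weight of `πₖ₊₁` in `νₙ₊₁`, both indices being predecessors: (k+1)/(n+1) for
  -- `ν`, and 1 for `ν̃`. `w-refl` serves the identity law, `w-trans` the compatibility with
  -- truncation.
  module _
    (w : ℕ → ℕ → R.Carrier)
    (w-refl : ∀ n → w n n R.≈ R.1#)
    (w-trans : ∀ l m n → w m n R.* w l m R.≈ w l n)
    (ν : ∀ n {X} → S (suc n) X ⇒ S n X × S n X)
    (π₀-ν : ∀ n {X} → π₀ ∘ ν n {X} ≈ s (n≤1+n n))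
    (π-ν : ∀ n {X} i → π {n} i ∘ (π₁ ∘ ν n {X}) ≈ w (toℕ i) n *ₗ π {suc n} (suc i))
    (t : ∀ n {X Y} → X ⇒ Y → S n X ⇒ Y)
    (t-zero : ∀ {X Y} (f : X ⇒ Y) → t zero f ≈ f)
    (t-suc : ∀ n {X Y} (f : X ⇒ Y) → t (suc n) f ≈ D (t n f) ∘ ν n)
    where

    -- Same body as in `Taylor`, so instantiating `t` yields the original `T` and `T̃` by unfolding.
    T : ∀ n {X Y} → X ⇒ Y → S n X ⇒ S n Y
    T n f = tupleS n (λ i → t (toℕ i) f ∘ s (toℕ≤pred[n] i))

    t-cong : ∀ n {X Y} {f g : X ⇒ Y} → f ≈ g → t n f ≈ t n g
    t-cong zero    {f = f} {g} p = trans (t-zero f) (trans p (sym (t-zero g)))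
    t-cong (suc n) {f = f} {g} p =
      trans (t-suc n f) (trans (∘-congʳ (D-cong (t-cong n p))) (sym (t-suc n g)))

    -- With `m` separate from `toℕ i`, this also covers injected indices, whose value is known only
    -- propositionally.
    π-T : ∀ {m n X Y} (f : X ⇒ Y) (i : Fin (suc n)) (m≤n : m ≤ n) → toℕ i ≡ m →
          π {n} i ∘ T n f ≈ t m f ∘ s m≤n
    π-T {n = n} f i m≤n ≡.refl = π-tuple n _ i

    -- Coordinate i of `T` depends only on input coordinates 0 to i, and its formula does not
    -- mention the ambient order.
    T-s : ∀ {m n X Y} (f : X ⇒ Y) (m≤n : m ≤ n) → T m f ∘ s m≤n ≈ s m≤n ∘ T n f
    T-s {m} {n} f m≤n = π-ext m λ i →
      let i≤m = toℕ≤pred[n] i ; i≤n = ≤-trans i≤m m≤n in begin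
      π i ∘ (T m f ∘ s m≤n)                       ≈⟨ pullˡ (π-T f i i≤m ≡.refl) ⟩
      (t (toℕ i) f ∘ s i≤m) ∘ s m≤n               ≈⟨ pullʳ (s-∘ i≤m m≤n i≤n) ⟩
      t (toℕ i) f ∘ s i≤n                         ≈⟨ π-T f _ i≤n (toℕ-inject≤ i (s≤s m≤n)) ⟨
      π {n} (inject≤ i (s≤s m≤n)) ∘ T n f         ≈⟨ pullˡ (π-s m≤n i) ⟨
      π i ∘ (s m≤n ∘ T n f)                       ∎

    -- Truncation and differentiation along `ν`.

    π₀-ν-s : ∀ {m n X} (m≤n : m ≤ n) →
             s m≤n ∘ (π₀ ∘ ν n {X}) ≈ π₀ ∘ (ν m ∘ s (s≤s m≤n))
    π₀-ν-s {m} {n} m≤n = begin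
      s m≤n ∘ (π₀ ∘ ν n)              ≈⟨ ∘-congˡ (π₀-ν n) ⟩
      s m≤n ∘ s (n≤1+n n)             ≈⟨ s-∘ m≤n (n≤1+n n) m≤1+n ⟩
      s m≤1+n                         ≈⟨ s-∘ (n≤1+n m) (s≤s m≤n) m≤1+n ⟨
      s (n≤1+n m) ∘ s (s≤s m≤n)       ≈⟨ pullˡ (π₀-ν m) ⟨
      π₀ ∘ (ν m ∘ s (s≤s m≤n))        ∎
      where m≤1+n = ≤-trans m≤n (n≤1+n n)

    π₁-ν-s : ∀ {m n X} (m≤n : m ≤ n) →
             s m≤n ∘ (π₁ ∘ ν n {X}) ≈ w m n *ₗ (π₁ ∘ (ν m ∘ s (s≤s m≤n)))
    π₁-ν-s {m} {n} {X} m≤n = π-ext m λ i → begin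
      π i ∘ (s m≤n ∘ (π₁ ∘ ν n))
        ≈⟨ pullˡ (π-s m≤n i) ⟩
      π {n} (inject≤ i (s≤s m≤n)) ∘ (π₁ ∘ ν n)
        ≈⟨ π-ν n _ ⟩
      w (toℕ (inject≤ i (s≤s m≤n))) n *ₗ π {suc n} (suc (inject≤ i (s≤s m≤n)))
        ≡⟨ ≡.cong (λ k → w k n *ₗ π {suc n} (suc (inject≤ i (s≤s m≤n)))) (toℕ-inject≤ i _) ⟩
      w (toℕ i) n *ₗ π {suc n} (suc (inject≤ i (s≤s m≤n)))
        -- Read backwards, `w-trans` splits off `w m n`, which is independent of `i` and can leave
        -- the tuple.
        ≈⟨ *ₗ-cong (w-trans (toℕ i) m n) (π-s (s≤s m≤n) (suc i)) ⟨
      (w m n R.* w (toℕ i) m) *ₗ (π {suc m} (suc i) ∘ s (s≤s m≤n))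
        ≈⟨ *ₗ-assoc _ _ _ ⟩
      w m n *ₗ (w (toℕ i) m *ₗ (π {suc m} (suc i) ∘ s (s≤s m≤n)))
        ≈⟨ *ₗ-cong R.refl (*ₗ-∘ _ _ _) ⟨
      w m n *ₗ ((w (toℕ i) m *ₗ π {suc m} (suc i)) ∘ s (s≤s m≤n))
        ≈⟨ *ₗ-cong R.refl (∘-congʳ (π-ν m i)) ⟨
      w m n *ₗ ((π i ∘ (π₁ ∘ ν m)) ∘ s (s≤s m≤n))
        ≈⟨ *ₗ-cong R.refl (pullʳ assoc) ⟩
      w m n *ₗ (π i ∘ (π₁ ∘ (ν m ∘ s (s≤s m≤n))))
        ≈⟨ proj-*ₗ (replicate (suc m) X) i _ _ ⟨
      π i ∘ (w m n *ₗ (π₁ ∘ (ν m ∘ s (s≤s m≤n)))) ∎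

    D-s : ∀ {m n X} (m≤n : m ≤ n) → D (s {X = X} m≤n) ≈ s m≤n ∘ π₁
    D-s {m} {n} {X} m≤n = π-ext m λ i → begin
      π i ∘ D (s m≤n)                        ≈⟨ proj-D (replicate (suc m) X) i _ ⟩
      D (π i ∘ s m≤n)                        ≈⟨ D-cong (π-s m≤n i) ⟩
      D (π {n} (inject≤ i (s≤s m≤n)))        ≈⟨ D-proj (replicate (suc n) X) _ ⟩
      π {n} (inject≤ i (s≤s m≤n)) ∘ π₁       ≈⟨ pullˡ (π-s m≤n i) ⟨
      π i ∘ (s m≤n ∘ π₁)                     ∎

    D-t-s : ∀ {m n X Y} (f : X ⇒ Y) (m≤n : m ≤ n) →
            D (t m f ∘ s m≤n) ∘ ν n ≈ w m n *ₗ (t (suc m) f ∘ s (s≤s m≤n))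
    D-t-s {m} {n} f m≤n = begin
      D (t m f ∘ s m≤n) ∘ ν n
        ≈⟨ D-∘₂ _ _ _ ⟩
      D (t m f) ∘ ⟨ s m≤n ∘ (π₀ ∘ ν n) , D (s m≤n) ∘ ν n ⟩
        ≈⟨ ∘-congˡ (⟨⟩-cong (π₀-ν-s m≤n) (trans (∘-congʳ (D-s m≤n)) (trans assoc (π₁-ν-s m≤n)))) ⟩
      D (t m f) ∘ ⟨ π₀ ∘ v , w m n *ₗ (π₁ ∘ v) ⟩
        -- Homogeneity of `D` in its second argument alone releases the factor; the base point
        -- `π₀ ∘ v` is unscaled.
        ≈⟨ additive-*ₗ (D-additive₂ (t m f) (π₀ ∘ v)) (w m n) (π₁ ∘ v) ⟩
      w m n *ₗ (D (t m f) ∘ ⟨ π₀ ∘ v , π₁ ∘ v ⟩)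
        ≈⟨ *ₗ-cong R.refl (∘-congˡ (⟨⟩-unique refl refl)) ⟨
      w m n *ₗ (D (t m f) ∘ v)
        ≈⟨ *ₗ-cong R.refl (pullˡ (sym (t-suc m f))) ⟩
      w m n *ₗ (t (suc m) f ∘ s (s≤s m≤n)) ∎
      where v = ν m ∘ s (s≤s m≤n)

    -- The left side has the shape that `D-∘₂` produces. Its base point is handled by `T-s`,
    -- coordinate i of its vector part by `D-t-s` at `m = toℕ i`.
    ν-natural : ∀ n {X Y} (f : X ⇒ Y) →
                ⟨ T n f ∘ (π₀ ∘ ν n) , D (T n f) ∘ ν n ⟩ ≈ ν n ∘ T (suc n) f
    ν-natural n {X} {Y} f = ×-ext fst (π-ext n snd)
      where
      fst = begin
        π₀ ∘ ⟨ T n f ∘ (π₀ ∘ ν n) , D (T n f) ∘ ν n ⟩   ≈⟨ π₀-⟨⟩ ⟩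
        T n f ∘ (π₀ ∘ ν n)                              ≈⟨ ∘-congˡ (π₀-ν n) ⟩
        T n f ∘ s (n≤1+n n)                             ≈⟨ T-s f (n≤1+n n) ⟩
        s (n≤1+n n) ∘ T (suc n) f                       ≈⟨ pullˡ (π₀-ν n) ⟨
        π₀ ∘ (ν n ∘ T (suc n) f)                        ∎

      snd : ∀ i → _
      snd i = begin
        π i ∘ (π₁ ∘ ⟨ T n f ∘ (π₀ ∘ ν n) , D (T n f) ∘ ν n ⟩)
          ≈⟨ ∘-congˡ π₁-⟨⟩ ⟩
        π i ∘ (D (T n f) ∘ ν n)
          ≈⟨ pullˡ (proj-D (replicate (suc n) Y) i (T n f)) ⟩
        D (π i ∘ T n f) ∘ ν n
          ≈⟨ ∘-congʳ (D-cong (π-T f i (toℕ≤pred[n] i) ≡.refl)) ⟩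
        D (t (toℕ i) f ∘ s (toℕ≤pred[n] i)) ∘ ν n
          ≈⟨ D-t-s f (toℕ≤pred[n] i) ⟩
        w (toℕ i) n *ₗ (t (suc (toℕ i)) f ∘ s (s≤s (toℕ≤pred[n] i)))
          ≈⟨ *ₗ-cong R.refl (π-T f (suc i) (s≤s (toℕ≤pred[n] i)) ≡.refl) ⟨
        w (toℕ i) n *ₗ (π {suc n} (suc i) ∘ T (suc n) f)
          ≈⟨ *ₗ-∘ _ _ _ ⟨
        (w (toℕ i) n *ₗ π {suc n} (suc i)) ∘ T (suc n) f
          ≈⟨ ∘-congʳ (π-ν n i) ⟨
        (π i ∘ (π₁ ∘ ν n)) ∘ T (suc n) f
          ≈⟨ pullʳ assoc ⟩
        π i ∘ (π₁ ∘ (ν n ∘ T (suc n) f)) ∎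

    -- Composition, identities and the functor laws.

    t-∘ : ∀ n {X Y Z} (g : Y ⇒ Z) (f : X ⇒ Y) → t n (g ∘ f) ≈ t n g ∘ T n f
    t-∘ zero    g f = begin
      t zero (g ∘ f)           ≈⟨ t-zero _ ⟩
      g ∘ f                    ≈⟨ ∘-cong (t-zero g) (t-zero f) ⟨
      -- `T zero f` unfolds to `t zero f ∘ id`: a one-fold tuple is its only entry, and the
      -- truncation of `S 0` to itself is `id`.
      t zero g ∘ t zero f      ≈⟨ ∘-congˡ identityʳ ⟨
      t zero g ∘ T zero f      ∎
    t-∘ (suc n) g f = begin
      t (suc n) (g ∘ f)                                           ≈⟨ t-suc n _ ⟩
      D (t n (g ∘ f)) ∘ ν n                                       ≈⟨ ∘-congʳ (D-cong (t-∘ n g f)) ⟩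
      D (t n g ∘ T n f) ∘ ν n                                     ≈⟨ D-∘₂ _ _ _ ⟩
      D (t n g) ∘ ⟨ T n f ∘ (π₀ ∘ ν n) , D (T n f) ∘ ν n ⟩        ≈⟨ ∘-congˡ (ν-natural n f) ⟩
      D (t n g) ∘ (ν n ∘ T (suc n) f)                             ≈⟨ pullˡ (sym (t-suc n g)) ⟩
      t (suc n) g ∘ T (suc n) f                                   ∎

    -- Differentiating the last projection gives the last entry of the vector part of `ν n`, which
    -- is the new top coordinate with weight `w n n`, that is 1.
    t-id : ∀ n {X} → t n (id {X}) ≈ π {n} (fromℕ n)
    t-id zero        = t-zero id
    t-id (suc n) {X} = begin
      t (suc n) id                                    ≈⟨ t-suc n id ⟩
      D (t n id) ∘ ν n                                ≈⟨ ∘-congʳ (D-cong (t-id n)) ⟩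
      D (π {n} (fromℕ n)) ∘ ν n                       ≈⟨ ∘-congʳ (D-proj (replicate (suc n) X) _) ⟩
      (π {n} (fromℕ n) ∘ π₁) ∘ ν n                    ≈⟨ assoc ⟩
      π {n} (fromℕ n) ∘ (π₁ ∘ ν n)                    ≈⟨ π-ν n _ ⟩
      w (toℕ (fromℕ n)) n *ₗ π {suc n} (fromℕ (suc n))
        ≡⟨ ≡.cong (λ k → w k n *ₗ π {suc n} (fromℕ (suc n))) (toℕ-fromℕ n) ⟩
      w n n *ₗ π {suc n} (fromℕ (suc n))              ≈⟨ *ₗ-cong (w-refl n) refl ⟩
      R.1# *ₗ π {suc n} (fromℕ (suc n))               ≈⟨ *ₗ-identityˡ _ ⟩
      π {suc n} (fromℕ (suc n))                       ∎

    T-isFunctor : ∀ n → IsFunctor category category (S n) (T n)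
    T-isFunctor n = record
      { F-cong = λ {_} {_} {f} {g} p → π-ext n λ i → begin
          π i ∘ T n f                            ≈⟨ π-T f i (i≤n i) ≡.refl ⟩
          t (toℕ i) f ∘ s (i≤n i)                ≈⟨ ∘-congʳ (t-cong (toℕ i) p) ⟩
          t (toℕ i) g ∘ s (i≤n i)                ≈⟨ π-T g i (i≤n i) ≡.refl ⟨
          π i ∘ T n g                            ∎
      ; F-identity = π-ext n λ i → begin
          π i ∘ T n id                           ≈⟨ π-T id i (i≤n i) ≡.refl ⟩
          t (toℕ i) id ∘ s (i≤n i)               ≈⟨ ∘-congʳ (t-id (toℕ i)) ⟩
          π {toℕ i} (fromℕ (toℕ i)) ∘ s (i≤n i)  ≈⟨ π-s (i≤n i) _ ⟩
          π {n} (inject≤ (fromℕ (toℕ i)) (s≤s (i≤n i)))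
            -- The top index of `Fin (suc (toℕ i))` injects to `i`, since both have value `toℕ i`.
            ≡⟨ ≡.cong (π {n}) (toℕ-injective
                 (≡.trans (toℕ-inject≤ (fromℕ (toℕ i)) _) (toℕ-fromℕ (toℕ i)))) ⟩
          π {n} i                                ≈⟨ identityʳ ⟨
          π {n} i ∘ id                           ∎
      ; F-∘ = λ {_} {_} {_} {f} {g} → π-ext n λ i → begin
          π i ∘ T n (g ∘ f)                      ≈⟨ π-T (g ∘ f) i (i≤n i) ≡.refl ⟩
          t (toℕ i) (g ∘ f) ∘ s (i≤n i)          ≈⟨ ∘-congʳ (t-∘ (toℕ i) g f) ⟩
          (t (toℕ i) g ∘ T (toℕ i) f) ∘ s (i≤n i) ≈⟨ pullʳ (T-s f (i≤n i)) ⟩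
          t (toℕ i) g ∘ (s (i≤n i) ∘ T n f)      ≈⟨ assoc ⟨
          (t (toℕ i) g ∘ s (i≤n i)) ∘ T n f      ≈⟨ ∘-congʳ (π-T g i (i≤n i) ≡.refl) ⟨
          (π i ∘ T n g) ∘ T n f                  ≈⟨ assoc ⟩
          π i ∘ (T n g ∘ T n f)                  ∎
      }
      where
      i≤n : (i : Fin (suc n)) → toℕ i ≤ n
      i≤n = toℕ≤pred[n]

-- Arithmetic of the fractional weights.

module Weights {r ℓr} {R : CommutativeSemiring r ℓr} (reciprocals : HasReciprocals R) where
  open CommutativeSemiring R
  open RawSemiringDefinitions rawSemiring using () renaming (_×_ to _·_)
  open HasReciprocals reciprocals
  open SetoidReasoning setoid

  /-refl : ∀ n → suc n / suc n ≈ 1#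
  /-refl n = trans (*-comm _ _) (1/-inverse (suc n))

  -- Commuting the two fractions puts `1/ suc m` next to `m′`, where they cancel.
  /-trans : ∀ l m n → (suc m / suc n) * (suc l / suc m) ≈ suc l / suc n
  /-trans l m n = begin
    (m′ * 1/ suc n) * (l′ * 1/ suc m)     ≈⟨ *-comm _ _ ⟩
    (l′ * 1/ suc m) * (m′ * 1/ suc n)     ≈⟨ *-assoc _ _ _ ⟩
    l′ * (1/ suc m * (m′ * 1/ suc n))     ≈⟨ *-congˡ (*-assoc _ _ _) ⟨
    l′ * ((1/ suc m * m′) * 1/ suc n)     ≈⟨ *-congˡ (*-congʳ (1/-inverse (suc m))) ⟩
    l′ * (1# * 1/ suc n)                  ≈⟨ *-congˡ (*-identityˡ _) ⟩
    l′ * 1/ suc n                         ∎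
    where
    l′ = suc l · 1#
    m′ = suc m · 1#

-- The two choices of weights.

open import Data.Product.Base using (_×_; _,_)

theorem4 : ∀ {r ℓr o ℓ e : Level} {R : CommutativeSemiring r ℓr}
    (reciprocals : HasReciprocals R) (C : CartesianDifferentialCategory R o ℓ e) (n : ℕ) →
  let open CartesianDifferentialCategory C using (category)
      open Taylor reciprocals C
  in IsFunctor category category (S n) (T n) × IsFunctor category category (S n) (T̃ n)
theorem4 {R = R} reciprocals C n =
    T-isFunctor (λ k m → suc k / suc m) /-refl /-trans
      ν (λ _ → π₀-⟨⟩) (λ m i → trans (∘-congˡ π₁-⟨⟩) (π-tuple m _ i))
      t (λ _ → refl) (λ _ _ → refl) n
  , T-isFunctor (λ _ _ → 1#) (λ _ → R.refl) (λ _ _ _ → R.*-identityˡ _)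
      ν̃ (λ _ → π₀-⟨⟩)
      -- `ν̃` has bare projections as entries, so the weight 1 is inserted by the unit law of the
      -- scalar action.
      (λ m i → trans (∘-congˡ π₁-⟨⟩) (trans (π-tuple m _ i) (sym (*ₗ-identityˡ _))))
      t̃ (λ _ → refl) (λ _ _ → refl) n
  where
  module R = CommutativeSemiring R
  open R using (1#)
  open HasReciprocals reciprocals using (_/_)
  open CartesianDifferentialCategory C using (π₀-⟨⟩; π₁-⟨⟩)
  open Taylor reciprocals C using (ν; ν̃; t; t̃)
  open DifferentialLemmas C using (refl; sym; trans; ∘-congˡ; *ₗ-identityˡ)
  open WeightedTaylor reciprocals C using (π-tuple; T-isFunctor)
  open Weights reciprocals
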